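{- Let $\sigma,\pi\in S_n$. Then $\sigma\sim\pi$ (i.e. $\sigma$ and $\pi$ are geo-equivalent) if and only if there exists $\rho\in S_n$ such that (1) $\rho\ast E(\sigma)=E(\pi)$; and (2) $\rho$ is either order-preserving on $E(\sigma)$ (that is, on every element of $E(\sigma)$) or order-reversing on $E(\sigma)$ (that is, on every element of $E(\sigma)$).
   Context: Inversion set: $E(\pi)=\{(i,j):1\le i<j\le n,\ \pi^{ -1}(i)>\pi^{ -1}(j)\}$. Action: for $\sigma,\rho\in S_n$ and $(i,j)\in E(\sigma)$, $\rho\ast(i,j)=(\rho(i),\rho(j))$ if $\rho(i)<\rho(j)$ ($\rho$ is order-preserving on $(i,j)$) and $\rho\ast(i,j)=(\rho(j),\rho(i))$ if $\rho(i)>\rho(j)$ ($\rho$ is order-reversing on $(i,j)$); $\rho\ast E(\sigma)=\{\rho\ast(i,j):(i,j)\in E(\sigma)\}$. Geometric graphs: a geometric graph is a simple graph together with a straight-line drawing in the plane with vertices in general position (no three vertices collinear, no three edges crossing at a single point). Two edges cross if they meet at a point interior to both. A geo-isomorphism $f:\overline{G}\to\overline{H}$ is a bijection $f:V(G)\to V(H)$ such that $uv\in E(G)\iff f(u)f(v)\in E(H)$, and $xy$ crosses $uv$ in $\overline G$ iff $f(x)f(y)$ crosses $f(u)f(v)$ in $\overline H$. The vertex set of $K_{2,n}$ is $\{a,b\}\cup\{1,\dots,n\}$, with $a$ and $b$ each adjacent to all of $1,\dots,n$. Realization $\overline{K}_{2,n}(\pi)$ for $\pi\in S_n$: from each of two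 points $a,b\in\mathbb{R}^2$ draw $n$ rays, all on the same side of the line $ab$, such that each ray from $a$ meets each ray from $b$ (and generic, so that general position holds). Label the rays from $b$ as $1,\dots,n$ in increasing order of the angle they make with the segment $ba$; label the rays from $a$ as $\pi(1),\dots,\pi(n)$ in increasing order of the angle they make with the segment $ab$. Place vertex $i$ at the intersection of the two rays labeled $i$, and draw the segments $ai$, $bi$ for all $i$. Geo-equivalence: $\sigma\sim\pi$ iff $\overline{K}_{2,n}(\sigma)$ and $\overline{K}_{2,n}(\pi)$ are geo-isomorphic. -}

module Defs where

open import Level using (0ℓ; suc; _⊔_)
open import Algebra.Apartness.Bundles using (HeytingField)
open import Data.Bool.Base using (if_then_else_)
open import Data.Fin.Base as Fin using (Fin)
open import Data.Fin.Properties as Fin using ()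
open import Data.Fin.Permutation using (Permutation′; _⟨$⟩ʳ_; _⟨$⟩ˡ_)
open import Data.Nat.Base using (ℕ)
open import Data.Product.Base using (∃-syntax; _×_; _,_; proj₁)
open import Data.Sum.Base using (_⊎_; [_,_]′)
open import Function.Bundles using (_↔_; _⇔_; Inverse)
open import Relation.Binary.Core using (Rel)
open import Relation.Binary.Definitions using (Symmetric)
open import Relation.Binary.PropositionalEquality.Core using (_≡_; _≢_)
open import Relation.Binary.Structures using (IsStrictPartialOrder)
open import Relation.Nullary using (¬_; does)
open import Relation.Unary using (Pred; _∈_)

-- The labels 1, …, n are the
-- elements of Fin n, and π(i) is π ⟨$⟩ʳ i.

E : ∀ {n} → Permutation′ n → Pred (Fin n × Fin n) 0ℓ
E π (i , j) = i Fin.< j × (π ⟨$⟩ˡ j) Fin.< (π ⟨$⟩ˡ i)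

OrderPreserving : ∀ {n} → Permutation′ n → Pred (Fin n × Fin n) 0ℓ
OrderPreserving ρ (i , j) = (ρ ⟨$⟩ʳ i) Fin.< (ρ ⟨$⟩ʳ j)

OrderReversing : ∀ {n} → Permutation′ n → Pred (Fin n × Fin n) 0ℓ
OrderReversing ρ (i , j) = (ρ ⟨$⟩ʳ j) Fin.< (ρ ⟨$⟩ʳ i)

infixr 7 _∗_ _∗ˢ_

_∗_ : ∀ {n} → Permutation′ n → Fin n × Fin n → Fin n × Fin n
ρ ∗ (i , j) =
  if does ((ρ ⟨$⟩ʳ i) Fin.<? (ρ ⟨$⟩ʳ j))
  then (ρ ⟨$⟩ʳ i , ρ ⟨$⟩ʳ j)
  else (ρ ⟨$⟩ʳ j , ρ ⟨$⟩ʳ i)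

_∗ˢ_ : ∀ {n} → Permutation′ n → Pred (Fin n × Fin n) 0ℓ → Pred (Fin n × Fin n) 0ℓ
(ρ ∗ˢ A) q = ∃[ p ] p ∈ A × q ≡ ρ ∗ p

record SimpleGraph : Set₁ where
  field
    Vertex : Set
    Adj    : Rel Vertex 0ℓ
    sym    : Symmetric Adj
    irrefl : ∀ {x} → ¬ Adj x x

data K₂-Vertex (n : ℕ) : Set where
  a b  : K₂-Vertex n
  leaf : Fin n → K₂-Vertex n

data K₂-Adj {n : ℕ} : Rel (K₂-Vertex n) 0ℓ where
  a–leaf : ∀ {i} → K₂-Adj a (leaf i)
  leaf–a : ∀ {i} → K₂-Adj (leaf i) a
  b–leaf : ∀ {i} → K₂-Adj b (leaf i)
  leaf–b : ∀ {i} → K₂-Adj (leaf i) b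

K₂ : ℕ → SimpleGraph
K₂ n = record
  { Vertex = K₂-Vertex n
  ; Adj    = K₂-Adj
  ; sym    = λ where
      a–leaf → leaf–a
      leaf–a → a–leaf
      b–leaf → leaf–b
      leaf–b → b–leaf
  ; irrefl = λ ()
  }

-- The ordered pairs (x , y) and (u , v) name the same undirected edge.
SameEdge : ∀ {V : Set} → V × V → V × V → Set
SameEdge (x , y) (u , v) = (x ≡ u × y ≡ v) ⊎ (x ≡ v × y ≡ u)

-- Ordered fields.  The real numbers are not available as a type, so the
-- plane is taken over an arbitrary ordered field.  No decidability of
-- the order is assumed: x # y is x < y or y < x.  Read classically, with
-- _#_ the negation of _≈_, these are exactly the ordered fields, and the
-- real numbers are an instance both classically and constructively.

record OrderedField c ℓ₁ ℓ₂ ℓ₃ : Set (suc (c ⊔ ℓ₁ ⊔ ℓ₂ ⊔ ℓ₃)) where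
  infix 4 _<_
  field
    heytingField : HeytingField c ℓ₁ ℓ₂

  open HeytingField heytingField public

  field
    _<_                  : Rel Carrier ℓ₃
    isStrictPartialOrder : IsStrictPartialOrder _≈_ _<_
    #⇒<⊎>                : ∀ {x y} → x # y → x < y ⊎ y < x
    <⇒#                  : ∀ {x y} → x < y → x # y
    +-monoˡ-<            : ∀ {x y} z → x < y → x + z < y + z
    0<x*y                : ∀ {x y} → 0# < x → 0# < y → 0# < x * y

module Plane {c ℓ₁ ℓ₂ ℓ₃} (F : OrderedField c ℓ₁ ℓ₂ ℓ₃) where

  open OrderedField F

  Point : Set c
  Point = Carrier × Carrier

  infix 4 _≈ₚ_ _#ₚ_
  infixl 6 _+ᵥ_ _-ᵥ_
  infixr 7 _·_

  _≈ₚ_ : Rel Point ℓ₁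
  (x , y) ≈ₚ (x′ , y′) = x ≈ x′ × y ≈ y′

  _#ₚ_ : Rel Point ℓ₂
  (x , y) #ₚ (x′ , y′) = x # x′ ⊎ y # y′

  _+ᵥ_ _-ᵥ_ : Point → Point → Point
  (x , y) +ᵥ (x′ , y′) = (x + x′ , y + y′)
  (x , y) -ᵥ (x′ , y′) = (x - x′ , y - y′)

  _·_ : Carrier → Point → Point
  t · (x , y) = (t * x , t * y)

  det : Point → Point → Carrier
  det (x , y) (x′ , y′) = x * y′ - y * x′

  -- Stated with apartness, which is classically the negation of ≈.
  NonCollinear : Point → Point → Point → Set ℓ₂
  NonCollinear p q r = det (q -ᵥ p) (r -ᵥ p) # 0#

  Interior : Point → Point → Point → Set (c ⊔ ℓ₁ ⊔ ℓ₃)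
  Interior p q z = ∃[ t ] 0# < t × t < 1# × z ≈ₚ p +ᵥ t · (q -ᵥ p)

  OnRay : Point → Point → Point → Set (c ⊔ ℓ₁ ⊔ ℓ₃)
  OnRay p d z = ∃[ t ] 0# < t × z ≈ₚ p +ᵥ t · d

  -- The sign of det v d tells on which side of a line with direction v
  -- the points p + t·d (t > 0, p on the line) lie.
  SameSide : Point → Point → Point → Set ℓ₃
  SameSide v d e = 0# < det v d * det v e

  -- For d and e on the same side of v: the angle between v and d is
  -- smaller than the angle between v and e, that is, the ray d lies
  -- inside the angle formed by v and e.
  SmallerAngle : Point → Point → Point → Set (c ⊔ ℓ₁ ⊔ ℓ₃)
  SmallerAngle v d e = ∃[ s ] ∃[ t ] 0# < s × 0# < t × d ≈ₚ s · v +ᵥ t · e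

  record GeneralPosition (G : SimpleGraph) (pos : SimpleGraph.Vertex G → Point)
                         : Set (c ⊔ ℓ₁ ⊔ ℓ₂ ⊔ ℓ₃) where
    open SimpleGraph G
    field
      distinct      : ∀ {x y} → x ≢ y → pos x #ₚ pos y
      noCollinear   : ∀ {x y z} → x ≢ y → y ≢ z → x ≢ z →
                      NonCollinear (pos x) (pos y) (pos z)
      noConcurrent  : ∀ {x₁ y₁ x₂ y₂ x₃ y₃} →
                      Adj x₁ y₁ → Adj x₂ y₂ → Adj x₃ y₃ →
                      ¬ SameEdge (x₁ , y₁) (x₂ , y₂) →
                      ¬ SameEdge (x₂ , y₂) (x₃ , y₃) →
                      ¬ SameEdge (x₁ , y₁) (x₃ , y₃) →
                      ¬ (∃[ z ] Interior (pos x₁) (pos y₁) z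
                              × Interior (pos x₂) (pos y₂) z
                              × Interior (pos x₃) (pos y₃) z)

  record GeometricGraph : Set (suc 0ℓ ⊔ c ⊔ ℓ₁ ⊔ ℓ₂ ⊔ ℓ₃) where
    field
      graph           : SimpleGraph
      pos             : SimpleGraph.Vertex graph → Point
      generalPosition : GeneralPosition graph pos

    open SimpleGraph graph public

    -- Crossing is a relation between two different edges.
    Crosses : Rel (Vertex × Vertex) (c ⊔ ℓ₁ ⊔ ℓ₃)
    Crosses (x , y) (u , v) =
      Adj x y × Adj u v × ¬ SameEdge (x , y) (u , v) ×
      ∃[ z ] Interior (pos x) (pos y) z × Interior (pos u) (pos v) z

  record GeoIsomorphism (G H : GeometricGraph) : Set (c ⊔ ℓ₁ ⊔ ℓ₃) where
    private
      module G = GeometricGraph G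
      module H = GeometricGraph H
    field
      bijection : G.Vertex ↔ H.Vertex

    f : G.Vertex → H.Vertex
    f = Inverse.to bijection

    field
      adjacent : ∀ u v → G.Adj u v ⇔ H.Adj (f u) (f v)
      crosses  : ∀ x y u v → G.Crosses (x , y) (u , v)
                           ⇔ H.Crosses (f x , f y) (f u , f v)

  placeK₂ : ∀ {n} → Point → Point → (Fin n → Point) → K₂-Vertex n → Point
  placeK₂ p q r a        = p
  placeK₂ p q r b        = q
  placeK₂ p q r (leaf i) = r i

  -- A realization of K₂,ₙ determined by π.  Both families of rays are
  -- indexed by label: the k-th ray from b has label k and the k-th ray
  -- from a has label π(k).  Vertex i is the intersection of the two rays
  -- labelled i.  Realizations exist for every π: take pa = (0 , 0),
  -- pb = (1 , 0) and directions (u , 1) from a and (- v , 1) from b, with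
  -- u and v positive, decreasing in the order of the rays, and otherwise generic.
  record Realization {n} (π : Permutation′ n) : Set (c ⊔ ℓ₁ ⊔ ℓ₂ ⊔ ℓ₃) where
    field
      pa pb     : Point
      rayA rayB : Fin n → Point

    ab : Point
    ab = pb -ᵥ pa

    ba : Point
    ba = pa -ᵥ pb

    ray : Fin n ⊎ Fin n → Point
    ray = [ rayA , rayB ]′

    field
      sameSide : ∀ r s → SameSide ab (ray r) (ray s)
      meet     : ∀ i j → ∃[ z ] OnRay pa (rayA i) z × OnRay pb (rayB j) z
      orderA   : ∀ {k l} → k Fin.< l →
                 SmallerAngle ab (rayA (π ⟨$⟩ʳ k)) (rayA (π ⟨$⟩ʳ l))
      orderB   : ∀ {k l} → k Fin.< l → SmallerAngle ba (rayB k) (rayB l)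

    pos : K₂-Vertex n → Point
    pos = placeK₂ pa pb (λ i → proj₁ (meet i i))

    field
      generalPosition : GeneralPosition (K₂ n) pos

    K̄ : GeometricGraph
    K̄ = record { graph = K₂ n; pos = pos; generalPosition = generalPosition }

  -- The drawing associated with a permutation depends on the choice of a
  -- realization; geo-equivalence is considered for given choices.
  GeoEquivalent : ∀ {n} {σ π : Permutation′ n} →
                  Realization σ → Realization π → Set (c ⊔ ℓ₁ ⊔ ℓ₃)
  GeoEquivalent S P = GeoIsomorphism (Realization.K̄ S) (Realization.K̄ P)

{-# OPTIONS --safe #-}

-- In a realization of K₂,ₙ(π) the edges a–i and b–j cross exactly when vertex j has the
-- smaller angle at b and vertex i the smaller angle at a, that is, when (j , i) ∈ E π, and no
-- two edges with a common endpoint cross.  A permutation ρ of the leaves with the two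
-- properties thus extends to a geo-isomorphism that fixes a and b (order-preserving case) or
-- exchanges them (order-reversing case).  Conversely, a graph automorphism of K₂,ₙ
-- permutes the leaves and fixes or exchanges a and b, except for n = 2; there E has at
-- most one element, and it is empty for both permutations or for neither, so ρ = id works.

module Submission where

open import Algebra.Apartness.Bundles using (HeytingCommutativeRing)
open import Algebra.Bundles using (CommutativeRing)
open import Data.Fin.Base as Fin using (Fin; zero; suc)
import Data.Fin.Properties as Fin
open import Data.Fin.Permutation as Perm using (Permutation′; _⟨$⟩ʳ_; _⟨$⟩ˡ_; inverseˡ; inverseʳ; permutation)
open import Data.Integer.Base as ℤ using (ℤ; +_; -[1+_]; _⊖_; _◃_)
import Data.Integer.Properties as ℤ
open import Data.Maybe.Base as Maybe using (Maybe)
open import Data.Nat.Base as ℕ using (ℕ; zero; suc; z<s; s<s)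
import Data.Nat.Properties as ℕ
open import Data.Product.Algebra using (×-comm)
open import Data.Product.Base using (∃-syntax; _×_; _,_; proj₁; proj₂)
open import Data.Product.Function.NonDependent.Propositional using (_×-↔_)
import Data.Sign.Base as Sign
open import Data.Sum.Base using (_⊎_; inj₁; inj₂)
open import Function.Base using (_∘_)
open import Function.Bundles using (_↔_; _⇔_; mk↔ₛ′; mk⇔; Inverse; Equivalence; Injection)
open import Function.Construct.Composition using (_↔-∘_)
open import Function.Properties.Inverse using (↔⇒↣)
open import Level using (0ℓ)
open import Relation.Binary.Consequences using (dec⇒weaklyDec)
open import Relation.Binary.Definitions using (tri<; tri≈; tri>)
open import Relation.Binary.PropositionalEquality as ≡ using (_≡_; _≢_; cong; subst; subst₂)
open import Relation.Binary.Structures using (IsStrictPartialOrder)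
open import Relation.Nullary using (¬_; contradiction)
open import Relation.Nullary.Decidable using (dec-true; dec-false)
open import Relation.Unary using (Pred; _∈_; _⊆_; _≐_)
open import Defs

-- Ordered fields

-- With integer coefficients the ring solver recognises cancellation although
-- equality in R is not decidable.
module IntegralRingSolver {c ℓ} (R : CommutativeRing c ℓ) where
  open CommutativeRing R
  open import Algebra.Properties.Ring ring using (-0#≈0#; -‿distribˡ-*; -‿distribʳ-*; -‿involutive)
  open import Algebra.Properties.AbelianGroup +-abelianGroup using (⁻¹-∙-comm)
  open import Algebra.Properties.CommutativeSemigroup +-commutativeSemigroup using (interchange)
  open import Algebra.Properties.Semiring.Mult.TCOptimised semiring
    using (×-homo-+; ×1-homo-*) renaming (_×_ to _⋆_)
  open import Algebra.Solver.Ring.AlmostCommutativeRing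
  open import Relation.Binary.Reasoning.Setoid setoid

  eval : ℤ → Carrier
  eval (+ n)    = n ⋆ 1#
  eval -[1+ n ] = - (suc n ⋆ 1#)

  eval-⊖ : ∀ m n → eval (m ⊖ n) ≈ m ⋆ 1# - n ⋆ 1#
  eval-⊖ m       zero    = sym (trans (+-congˡ -0#≈0#) (+-identityʳ (m ⋆ 1#)))
  eval-⊖ zero    (suc n) = sym (+-identityˡ (- (suc n ⋆ 1#)))
  eval-⊖ (suc m) (suc n) = begin
    eval (suc m ⊖ suc n)               ≡⟨ ≡.cong eval (ℤ.[1+m]⊖[1+n]≡m⊖n m n) ⟩
    eval (m ⊖ n)                       ≈⟨ eval-⊖ m n ⟩
    m ⋆ 1# - n ⋆ 1#                    ≈⟨ +-identityˡ _ ⟨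
    0# + (m ⋆ 1# - n ⋆ 1#)             ≈⟨ +-congʳ (-‿inverseʳ 1#) ⟨
    (1# - 1#) + (m ⋆ 1# - n ⋆ 1#)      ≈⟨ interchange 1# (- 1#) (m ⋆ 1#) (- (n ⋆ 1#)) ⟩
    (1# + m ⋆ 1#) + (- 1# - n ⋆ 1#)    ≈⟨ +-congˡ (⁻¹-∙-comm 1# (n ⋆ 1#)) ⟩
    (1# + m ⋆ 1#) - (1# + n ⋆ 1#)      ≈⟨ +-cong (×-homo-+ 1# 1 m) (-‿cong (×-homo-+ 1# 1 n)) ⟨
    suc m ⋆ 1# - suc n ⋆ 1#            ∎

  eval-+ : ∀ i j → eval (i ℤ.+ j) ≈ eval i + eval j
  eval-+ (+ m)    (+ n)    = ×-homo-+ 1# m n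
  eval-+ (+ m)    -[1+ n ] = eval-⊖ m (suc n)
  eval-+ -[1+ m ] (+ n)    = trans (eval-⊖ n (suc m)) (+-comm _ _)
  eval-+ -[1+ m ] -[1+ n ] = begin
    - (suc (suc (m ℕ.+ n)) ⋆ 1#)          ≡⟨ ≡.cong (λ k → - (suc k ⋆ 1#)) (ℕ.+-suc m n) ⟨
    - ((suc m ℕ.+ suc n) ⋆ 1#)            ≈⟨ -‿cong (×-homo-+ 1# (suc m) (suc n)) ⟩
    - (suc m ⋆ 1# + suc n ⋆ 1#)           ≈⟨ ⁻¹-∙-comm _ _ ⟨
    - (suc m ⋆ 1#) - suc n ⋆ 1#           ∎

  eval-+◃ : ∀ n → eval (Sign.+ ◃ n) ≈ n ⋆ 1#
  eval-+◃ n = reflexive (≡.cong eval (ℤ.+◃n≡+n n))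

  -- An integer product of mixed signs unfolds to `Sign.- ◃ m`, which for m = 0 is `+ 0` and not a
  -- negative constructor; hence the case split.
  eval--◃ : ∀ n → eval (Sign.- ◃ n) ≈ - (n ⋆ 1#)
  eval--◃ zero    = sym -0#≈0#
  eval--◃ (suc n) = refl

  eval-* : ∀ i j → eval (i ℤ.* j) ≈ eval i * eval j
  eval-* (+ m) (+ n) = trans (eval-+◃ (m ℕ.* n)) (×1-homo-* m n)
  eval-* (+ m) -[1+ n ] = begin
    eval (Sign.- ◃ m ℕ.* suc n)        ≈⟨ eval--◃ (m ℕ.* suc n) ⟩
    - ((m ℕ.* suc n) ⋆ 1#)             ≈⟨ -‿cong (×1-homo-* m (suc n)) ⟩
    - ((m ⋆ 1#) * (suc n ⋆ 1#))        ≈⟨ -‿distribʳ-* _ _ ⟩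
    (m ⋆ 1#) * - (suc n ⋆ 1#)          ∎
  eval-* -[1+ m ] (+ n) = begin
    eval (Sign.- ◃ suc m ℕ.* n)        ≈⟨ eval--◃ (suc m ℕ.* n) ⟩
    - ((suc m ℕ.* n) ⋆ 1#)             ≈⟨ -‿cong (×1-homo-* (suc m) n) ⟩
    - ((suc m ⋆ 1#) * (n ⋆ 1#))        ≈⟨ -‿distribˡ-* _ _ ⟩
    - (suc m ⋆ 1#) * (n ⋆ 1#)          ∎
  eval-* -[1+ m ] -[1+ n ] = begin
    (suc m ℕ.* suc n) ⋆ 1#                ≈⟨ ×1-homo-* (suc m) (suc n) ⟩
    (suc m ⋆ 1#) * (suc n ⋆ 1#)           ≈⟨ -‿involutive _ ⟨
    - - ((suc m ⋆ 1#) * (suc n ⋆ 1#))     ≈⟨ -‿cong (-‿distribˡ-* _ _) ⟩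
    - (- (suc m ⋆ 1#) * (suc n ⋆ 1#))     ≈⟨ -‿distribʳ-* _ _ ⟩
    - (suc m ⋆ 1#) * - (suc n ⋆ 1#)       ∎

  eval-neg : ∀ i → eval (ℤ.- i) ≈ - eval i
  eval-neg (+ zero)  = sym -0#≈0#
  eval-neg (+ suc n) = refl
  eval-neg -[1+ n ]  = sym (-‿involutive _)

  homomorphism : ℤ.+-*-rawRing -Raw-AlmostCommutative⟶ fromCommutativeRing R
  homomorphism = record
    { ⟦_⟧    = eval
    ; +-homo = eval-+
    ; *-homo = eval-*
    ; -‿homo = eval-neg
    ; 0-homo = refl
    ; 1-homo = refl
    }

  eval-cong? : ∀ i j → Maybe (eval i ≈ eval j)
  eval-cong? i j = Maybe.map (λ i≡j → reflexive (≡.cong eval i≡j)) (dec⇒weaklyDec ℤ._≟_ i j)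

  open import Algebra.Solver.Ring ℤ.+-*-rawRing (fromCommutativeRing R) homomorphism eval-cong? public
    using (Polynomial; solve; _:=_; _:+_; _:*_; _:-_; :-_; con)

  :0 :1 : ∀ {n} → Polynomial n
  :0 = con (+ 0)
  :1 = con (+ 1)

module OrderedFieldProperties {c ℓ₁ ℓ₂ ℓ₃} (F : OrderedField c ℓ₁ ℓ₂ ℓ₃) where
  open OrderedField F
  open IsStrictPartialOrder isStrictPartialOrder public
    using () renaming (irrefl to <-irrefl; trans to <-trans; asym to <-asym; <-resp-≈ to <-resp₂-≈)
  open import Algebra.Apartness.Properties.HeytingCommutativeRing heytingCommutativeRing
    using (1#0; x-0≈x; invertibleˡ⇒#)
  open import Relation.Binary.Reasoning.Setoid setoid
  open IntegralRingSolver (HeytingCommutativeRing.commutativeRing heytingCommutativeRing) public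
    using (solve; _:=_; _:+_; _:*_; _:-_; :-_; :0; :1)

  <-respʳ-≈ : ∀ {x y z} → y ≈ z → x < y → x < z
  <-respʳ-≈ = proj₁ <-resp₂-≈

  <-respˡ-≈ : ∀ {x y z} → y ≈ z → y < x → z < x
  <-respˡ-≈ = proj₂ <-resp₂-≈

  x<y⇒0<y-x : ∀ {x y} → x < y → 0# < y - x
  x<y⇒0<y-x {x} x<y = <-respˡ-≈ (-‿inverseʳ x) (+-monoˡ-< (- x) x<y)

  0<y-x⇒x<y : ∀ {x y} → 0# < y - x → x < y
  0<y-x⇒x<y {x} {y} 0<y-x =
    <-respˡ-≈ (+-identityˡ x) (<-respʳ-≈ (solve 2 (λ x y → y :- x :+ x := y) refl x y) (+-monoˡ-< x 0<y-x))

  0<x+y : ∀ {x y} → 0# < x → 0# < y → 0# < x + y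
  0<x+y {x} {y} 0<x 0<y = <-trans 0<y (<-respˡ-≈ (+-identityˡ y) (+-monoˡ-< y 0<x))

  -- The upper bounds on parameters of interior points are obtained this way, by exhibiting a
  -- positive complement.
  x+y≈1⇒x<1 : ∀ {x y} → 0# < y → x + y ≈ 1# → x < 1#
  x+y≈1⇒x<1 {x} {y} 0<y x+y≈1 =
    <-respˡ-≈ (+-identityˡ x) (<-respʳ-≈ (trans (+-comm y x) x+y≈1) (+-monoˡ-< x 0<y))

  x<0⇒0<-x : ∀ {x} → x < 0# → 0# < - x
  x<0⇒0<-x {x} x<0 = <-respʳ-≈ (+-identityˡ (- x)) (x<y⇒0<y-x x<0)

  -- Being apart from 0, the unit is positive or negative; if it were negative, its opposite would
  -- be positive, and so would the square of that, which is 1 again.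
  0<1 : 0# < 1#
  0<1 with #⇒<⊎> 1#0
  ... | inj₂ 0<1 = 0<1
  ... | inj₁ 1<0 = <-respʳ-≈ (solve 0 ((:- :1) :* (:- :1) := :1) refl) (0<x*y 0<-1 0<-1)
    where
    0<-1 : 0# < - 1#
    0<-1 = x<0⇒0<-x 1<0

  #0⇒inverse : ∀ {x} → x # 0# → ∃[ y ] x * y ≈ 1#
  -- `#⇒invertible` inverts the difference x - 0, which still has to be replaced by x.
  #0⇒inverse {x} x#0 with y , _ , xy≈1 ← #⇒invertible x#0 =
    y , trans (*-congʳ (sym (x-0≈x x))) xy≈1

  -- Multiply by the inverse of d. This is how non-collinearity enters below: d is a determinant
  -- apart from 0.
  *-cancelʳ-#0 : ∀ {x d} → d # 0# → x * d ≈ 0# → x ≈ 0#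
  *-cancelʳ-#0 {x} {d} d#0 xd≈0 with y , dy≈1 ← #0⇒inverse d#0 = begin
    x              ≈⟨ *-identityʳ x ⟨
    x * 1#         ≈⟨ *-congˡ dy≈1 ⟨
    x * (d * y)    ≈⟨ *-assoc x d y ⟨
    x * d * y      ≈⟨ *-congʳ xd≈0 ⟩
    0# * y         ≈⟨ zeroˡ y ⟩
    0#             ∎

  -- The inverse is itself invertible, hence apart from 0, so only a negative inverse has to be
  -- excluded.
  positive-inverse : ∀ {x} → 0# < x → ∃[ y ] 0# < y × x * y ≈ 1#
  positive-inverse {x} 0<x with y , xy≈1 ← #0⇒inverse (#-sym (<⇒# 0<x)) = y , 0<y , xy≈1
    where
    y#0 : y # 0#
    y#0 = invertibleˡ⇒# (x , trans (*-congˡ (x-0≈x y)) xy≈1)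

    0<y : 0# < y
    0<y with #⇒<⊎> y#0
    ... | inj₂ 0<y = 0<y
    ... | inj₁ y<0 = contradiction 0<1 (<-asym 1<0)
      where
      -- x · (−y) = −1 would be positive.
      1<0 : 1# < 0#
      1<0 = 0<y-x⇒x<y (<-respʳ-≈ x*-y≈0-1 (0<x*y 0<x (x<0⇒0<-x y<0)))
        where
        x*-y≈0-1 : x * - y ≈ 0# - 1#
        x*-y≈0-1 = trans (solve 2 (λ x y → x :* (:- y) := :- (x :* y)) refl x y)
                         (trans (-‿cong xy≈1) (sym (+-identityˡ (- 1#))))

-- Plane geometry

module PlaneProperties {c ℓ₁ ℓ₂ ℓ₃} (F : OrderedField c ℓ₁ ℓ₂ ℓ₃) where
  open Plane F
  open OrderedField F
  open OrderedFieldProperties F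
  open import Relation.Binary.Reasoning.Setoid setoid

  det-cong : ∀ {x x′ y y′} → x ≈ₚ x′ → y ≈ₚ y′ → det x y ≈ det x′ y′
  det-cong (x₁ , x₂) (y₁ , y₂) = +-cong (*-cong x₁ y₂) (-‿cong (*-cong x₂ y₁))

  det-· : ∀ α x y → det (α · x) y ≈ α * det x y
  det-· α (x₁ , x₂) (y₁ , y₂) =
    solve 5 (λ α x₁ x₂ y₁ y₂ → (α :* x₁) :* y₂ :- (α :* x₂) :* y₁ := α :* (x₁ :* y₂ :- x₂ :* y₁))
      refl α x₁ x₂ y₁ y₂

  det-+ᵥ : ∀ x x′ y → det (x +ᵥ x′) y ≈ det x y + det x′ y
  det-+ᵥ (x₁ , x₂) (x₁′ , x₂′) (y₁ , y₂) =
    solve 6 (λ x₁ x₂ x₁′ x₂′ y₁ y₂ →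
      (x₁ :+ x₁′) :* y₂ :- (x₂ :+ x₂′) :* y₁ := (x₁ :* y₂ :- x₂ :* y₁) :+ (x₁′ :* y₂ :- x₂′ :* y₁))
      refl x₁ x₂ x₁′ x₂′ y₁ y₂

  det-combination : ∀ {x u v} α β y → x ≈ₚ α · u +ᵥ β · v → det x y ≈ α * det u y + β * det v y
  det-combination {_} {u} {v} α β y x≈αu+βv =
    trans (det-cong x≈αu+βv (refl , refl))
      (trans (det-+ᵥ (α · u) (β · v) y) (+-cong (det-· α u y) (det-· β v y)))

  det-self : ∀ x → det x x ≈ 0#
  det-self (x₁ , x₂) = trans (+-congˡ (-‿cong (*-comm x₂ x₁))) (-‿inverseʳ (x₁ * x₂))

  det-swap : ∀ x y → det x y ≈ - det y x
  det-swap (x₁ , x₂) (y₁ , y₂) =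
    solve 4 (λ x₁ x₂ y₁ y₂ → x₁ :* y₂ :- x₂ :* y₁ := :- (y₁ :* x₂ :- y₂ :* x₁)) refl x₁ x₂ y₁ y₂

  -- Bilinearity after x - p = (x - q) - (p - q), and likewise for y. It relates the angle condition
  -- at one hub to the one at the other.
  det-rebase : ∀ p q x y →
               det (x -ᵥ p) (y -ᵥ p) ≈ det (x -ᵥ q) (y -ᵥ q) - det (x -ᵥ q) (p -ᵥ q) + det (y -ᵥ q) (p -ᵥ q)
  det-rebase (p₁ , p₂) (q₁ , q₂) (x₁ , x₂) (y₁ , y₂) =
    solve 8 (λ p₁ p₂ q₁ q₂ x₁ x₂ y₁ y₂ →
      (x₁ :- p₁) :* (y₂ :- p₂) :- (x₂ :- p₂) :* (y₁ :- p₁) :=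
      ((x₁ :- q₁) :* (y₂ :- q₂) :- (x₂ :- q₂) :* (y₁ :- q₁))
      :- ((x₁ :- q₁) :* (p₂ :- q₂) :- (x₂ :- q₂) :* (p₁ :- q₁))
      :+ ((y₁ :- q₁) :* (p₂ :- q₂) :- (y₂ :- q₂) :* (p₁ :- q₁)))
      refl p₁ p₂ q₁ q₂ x₁ x₂ y₁ y₂

  Interior-sym : ∀ {p q z} → Interior p q z → Interior q p z
  Interior-sym {p₁ , p₂} {q₁ , q₂} (t , 0<t , t<1 , z₁ , z₂) =
    1# - t , x<y⇒0<y-x t<1 ,
    x+y≈1⇒x<1 0<t (solve 1 (λ t → :1 :- t :+ t := :1) refl t) ,
    trans z₁ (reversed p₁ q₁) , trans z₂ (reversed p₂ q₂)
    where
    reversed : ∀ p q → p + t * (q - p) ≈ q + (1# - t) * (p - q)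
    reversed = solve 3 (λ t p q → p :+ t :* (q :- p) := q :+ (:1 :- t) :* (p :- q)) refl t

  x≈p+d⇒x-p≈d : ∀ {x p d} → x ≈ₚ p +ᵥ d → x -ᵥ p ≈ₚ d
  x≈p+d⇒x-p≈d (x₁ , x₂) = subtract x₁ , subtract x₂
    where
    subtract : ∀ {x p d} → x ≈ p + d → x - p ≈ d
    subtract {_} {p} {d} x≈p+d = trans (+-congʳ x≈p+d) (solve 2 (λ p d → p :+ d :- p := d) refl p d)

  -- With origin p a common point is both s X and t Y, so s det X Y = t det Y Y = 0, which forces s
  -- = 0.
  interiors-disjoint : ∀ {p x y z} → NonCollinear p x y → Interior p x z → ¬ Interior p y z
  interiors-disjoint {p} {x} {y} {z} nonCollinear (s , 0<s , _ , z≈) (t , _ , _ , z≈′) =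
    <-irrefl (sym (*-cancelʳ-#0 nonCollinear sD≈0)) 0<s
    where
    X = x -ᵥ p
    Y = y -ᵥ p

    sD≈0 : s * det X Y ≈ 0#
    sD≈0 = begin
      s * det X Y       ≈⟨ det-· s X Y ⟨
      det (s · X) Y     ≈⟨ det-cong (x≈p+d⇒x-p≈d z≈) (refl , refl) ⟨
      det (z -ᵥ p) Y    ≈⟨ det-cong (x≈p+d⇒x-p≈d z≈′) (refl , refl) ⟩
      det (t · Y) Y     ≈⟨ det-· t Y Y ⟩
      t * det Y Y       ≈⟨ *-congˡ (det-self Y) ⟩
      t * 0#            ≈⟨ zeroʳ t ⟩
      0#                ∎

  -- From d = s v + t e follows μ d = (μ s) v + (μ t / ν) (ν e), again with positive coefficients.
  SmallerAngle-scale : ∀ {v d e d′ e′ μ ν} → 0# < μ → 0# < ν → d′ ≈ₚ μ · d → e′ ≈ₚ ν · e →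
                       SmallerAngle v d e → SmallerAngle v d′ e′
  SmallerAngle-scale {μ = μ} {ν} 0<μ 0<ν (d′₁ , d′₂) (e′₁ , e′₂) (s , t , 0<s , 0<t , d₁ , d₂)
    with ν⁻¹ , 0<ν⁻¹ , νν⁻¹≈1 ← positive-inverse 0<ν =
    μ * s , μ * (t * ν⁻¹) , 0<x*y 0<μ 0<s , 0<x*y 0<μ (0<x*y 0<t 0<ν⁻¹) ,
    scaled d′₁ e′₁ d₁ , scaled d′₂ e′₂ d₂
    where
    scaled : ∀ {v d e d′ e′} → d′ ≈ μ * d → e′ ≈ ν * e → d ≈ s * v + t * e →
             d′ ≈ μ * s * v + μ * (t * ν⁻¹) * e′
    scaled {v} {d} {e} {d′} {e′} d′≈ e′≈ d≈ = begin
      d′                                        ≈⟨ d′≈ ⟩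
      μ * d                                     ≈⟨ *-congˡ d≈ ⟩
      μ * (s * v + t * e)                       ≈⟨ *-congˡ (+-congˡ (*-congˡ (*-identityˡ e))) ⟨
      μ * (s * v + t * (1# * e))                ≈⟨ *-congˡ (+-congˡ (*-congˡ (*-congʳ νν⁻¹≈1))) ⟨
      μ * (s * v + t * (ν * ν⁻¹ * e))           ≈⟨ solve 7 (λ μ s v t ν ν⁻¹ e →
                                                     μ :* (s :* v :+ t :* (ν :* ν⁻¹ :* e)) :=
                                                     μ :* s :* v :+ μ :* (t :* ν⁻¹) :* (ν :* e))
                                                     refl μ s v t ν ν⁻¹ e ⟩
      μ * s * v + μ * (t * ν⁻¹) * (ν * e)       ≈⟨ +-congˡ (*-congˡ e′≈) ⟨
      μ * s * v + μ * (t * ν⁻¹) * e′            ∎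

  -- Carries the angle order from ray directions, where a realization states it, to the vertices
  -- placed on the rays; the ray parameters are the scale factors.
  SmallerAngle-points : ∀ {v p d e x y} → OnRay p d x → OnRay p e y →
                        SmallerAngle v d e → SmallerAngle v (x -ᵥ p) (y -ᵥ p)
  SmallerAngle-points (_ , 0<μ , x≈) (_ , 0<ν , y≈) =
    SmallerAngle-scale 0<μ 0<ν (x≈p+d⇒x-p≈d x≈) (x≈p+d⇒x-p≈d y≈)

  -- With origin q, a common point (1 − τ) W + τ X is parallel to Y, but its determinant
  -- with Y is a positive multiple of det W Y.
  smallerAngle⇒disjoint : ∀ {p q x y z} → NonCollinear q p y → SmallerAngle (p -ᵥ q) (x -ᵥ q) (y -ᵥ q) →
                          Interior p x z → ¬ Interior q y z
  smallerAngle⇒disjoint {p} {q} {x} {y} {z} nonCollinear (s , t , 0<s , _ , X≈)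
                        (τ , 0<τ , τ<1 , z₁ , z₂) (υ , _ , _ , z≈υY) =
    <-irrefl (sym (*-cancelʳ-#0 nonCollinear kD≈0)) (0<x+y (x<y⇒0<y-x τ<1) (0<x*y 0<τ 0<s))
    where
    W = p -ᵥ q
    X = x -ᵥ q
    Y = y -ᵥ q

    Z≈combination : z -ᵥ q ≈ₚ (1# - τ) · W +ᵥ τ · X
    Z≈combination = from-q z₁ , from-q z₂
      where
      from-q : ∀ {z p q x} → z ≈ p + τ * (x - p) → z - q ≈ (1# - τ) * (p - q) + τ * (x - q)
      from-q {_} {p} {q} {x} z≈ = trans (+-congʳ z≈)
        (solve 4 (λ τ p q x → p :+ τ :* (x :- p) :- q := (:1 :- τ) :* (p :- q) :+ τ :* (x :- q)) refl τ p q x)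

    kD≈0 : (1# - τ + τ * s) * det W Y ≈ 0#
    kD≈0 = begin
      (1# - τ + τ * s) * det W Y
        -- The term `t * :0` is inserted to become `t * det Y Y`, the second half of the expansion
        -- of det X Y.
        ≈⟨ solve 4 (λ τ s t D → (:1 :- τ :+ τ :* s) :* D := (:1 :- τ) :* D :+ τ :* (s :* D :+ t :* :0))
             refl τ s t (det W Y) ⟩
      (1# - τ) * det W Y + τ * (s * det W Y + t * 0#)
        ≈⟨ +-congˡ (*-congˡ (+-congˡ (*-congˡ (det-self Y)))) ⟨
      (1# - τ) * det W Y + τ * (s * det W Y + t * det Y Y)
        ≈⟨ +-congˡ (*-congˡ (det-combination s t Y X≈)) ⟨
      (1# - τ) * det W Y + τ * det X Y
        ≈⟨ det-combination (1# - τ) τ Y Z≈combination ⟨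
      det (z -ᵥ q) Y
        ≈⟨ det-cong (x≈p+d⇒x-p≈d z≈υY) (refl , refl) ⟩
      det (υ · Y) Y
        ≈⟨ det-· υ Y Y ⟩
      υ * det Y Y
        ≈⟨ *-congˡ (det-self Y) ⟩
      υ * 0#
        ≈⟨ zeroʳ υ ⟩
      0# ∎

  -- From Y = s W + t X the lines p x and q y meet at q + υ Y with υ = 1 / (s + t); the
  -- angle condition at p gives s + t = 1 + s′ t, so υ < 1.
  smallerAngles⇒cross : ∀ {p q x y} → NonCollinear q x p →
                        SmallerAngle (p -ᵥ q) (y -ᵥ q) (x -ᵥ q) → SmallerAngle (q -ᵥ p) (x -ᵥ p) (y -ᵥ p) →
                        ∃[ z ] Interior p x z × Interior q y z
  smallerAngles⇒cross {p} {q} {x} {y} nonCollinear (s , t , 0<s , 0<t , Y≈) (s′ , t′ , 0<s′ , _ , X′≈)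
    with υ , 0<υ , [s+t]υ≈1 ← positive-inverse (0<x+y 0<s 0<t) =
    q +ᵥ υ · Y ,
    -- On p x the parameter is υ t with complement υ s; on q y it is υ with complement υ s′ t.
    (υ * t , 0<x*y 0<υ 0<t , x+y≈1⇒x<1 (0<x*y 0<υ 0<s) υt+υs≈1 , from-p (proj₁ Y≈) , from-p (proj₂ Y≈)) ,
    (υ , 0<υ , x+y≈1⇒x<1 (0<x*y 0<υ (0<x*y 0<s′ 0<t)) υ+υs′t≈1 , refl , refl)
    where
    W = p -ᵥ q
    X = x -ᵥ q
    Y = y -ᵥ q
    X′ = x -ᵥ p
    Y′ = y -ᵥ p
    D = det X W

    -- The determinants tied together by `det-rebase` are all written as multiples of D, which can
    -- then be cancelled.
    det-Y-W : det Y W ≈ t * D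
    det-Y-W = begin
      det Y W                ≈⟨ det-combination s t W Y≈ ⟩
      s * det W W + t * D    ≈⟨ +-congʳ (*-congˡ (det-self W)) ⟩
      s * 0# + t * D         ≈⟨ +-congʳ (zeroʳ s) ⟩
      0# + t * D             ≈⟨ +-identityˡ (t * D) ⟩
      t * D                  ∎

    det-X-Y : det X Y ≈ s * D
    det-X-Y = begin
      det X Y                        ≈⟨ det-swap X Y ⟩
      - det Y X                      ≈⟨ -‿cong (det-combination s t X Y≈) ⟩
      - (s * det W X + t * det X X)  ≈⟨ -‿cong (+-cong (*-congˡ (det-swap W X)) (*-congˡ (det-self X))) ⟩
      - (s * - D + t * 0#)           ≈⟨ solve 3 (λ s t D → :- (s :* (:- D) :+ t :* :0) := s :* D) refl s t D ⟩
      s * D                          ∎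

    det-X′-Y′ : det X′ Y′ ≈ s′ * (t * D)
    det-X′-Y′ = begin
      det X′ Y′                                  ≈⟨ det-combination s′ t′ Y′ X′≈ ⟩
      s′ * det (q -ᵥ p) Y′ + t′ * det Y′ Y′      ≈⟨ +-cong (*-congˡ det-V-Y′) (*-congˡ (det-self Y′)) ⟩
      s′ * det Y W + t′ * 0#                     ≈⟨ +-congˡ (zeroʳ t′) ⟩
      s′ * det Y W + 0#                          ≈⟨ +-identityʳ _ ⟩
      s′ * det Y W                               ≈⟨ *-congˡ det-Y-W ⟩
      s′ * (t * D)                               ∎
      where
      -- Both sides are twice the oriented area of the triangle p q y, read from two of its corners.
      det-V-Y′ : det (q -ᵥ p) Y′ ≈ det Y W
      det-V-Y′ = solve 6 (λ p₁ p₂ q₁ q₂ y₁ y₂ →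
        (q₁ :- p₁) :* (y₂ :- p₂) :- (q₂ :- p₂) :* (y₁ :- p₁) :=
        (y₁ :- q₁) :* (p₂ :- q₂) :- (y₂ :- q₂) :* (p₁ :- q₁))
        refl (proj₁ p) (proj₂ p) (proj₁ q) (proj₂ q) (proj₁ y) (proj₂ y)

    -- Inserting the three multiples of D into `det-rebase` gives s D - D + t D = s′ t D.
    s+t-1≈s′t : s + t - 1# ≈ s′ * t
    s+t-1≈s′t = begin
      s + t - 1#
        ≈⟨ solve 3 (λ s t u → s :+ t :- :1 := (s :+ t :- :1 :- u) :+ u) refl s t (s′ * t) ⟩
      (s + t - 1# - s′ * t) + s′ * t
        ≈⟨ +-congʳ (*-cancelʳ-#0 nonCollinear (begin
             (s + t - 1# - s′ * t) * D
               ≈⟨ solve 4 (λ s t s′ D → (s :+ t :- :1 :- s′ :* t) :* D :=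
                                        s :* D :- D :+ t :* D :- s′ :* (t :* D)) refl s t s′ D ⟩
             s * D - D + t * D - s′ * (t * D)
               ≈⟨ +-cong (+-cong (+-congʳ det-X-Y) det-Y-W) (-‿cong det-X′-Y′) ⟨
             det X Y - D + det Y W - det X′ Y′
               ≈⟨ +-congʳ (det-rebase p q x y) ⟨
             det X′ Y′ - det X′ Y′
               ≈⟨ -‿inverseʳ (det X′ Y′) ⟩
             0# ∎)) ⟩
      0# + s′ * t
        ≈⟨ +-identityˡ (s′ * t) ⟩
      s′ * t ∎

    υt+υs≈1 : υ * t + υ * s ≈ 1#
    υt+υs≈1 = trans (solve 3 (λ υ s t → υ :* t :+ υ :* s := (s :+ t) :* υ) refl υ s t) [s+t]υ≈1

    υ+υs′t≈1 : υ + υ * (s′ * t) ≈ 1#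
    υ+υs′t≈1 = begin
      υ + υ * (s′ * t)        ≈⟨ +-congˡ (*-congˡ s+t-1≈s′t) ⟨
      υ + υ * (s + t - 1#)    ≈⟨ solve 3 (λ υ s t → υ :+ υ :* (s :+ t :- :1) := (s :+ t) :* υ) refl υ s t ⟩
      (s + t) * υ             ≈⟨ [s+t]υ≈1 ⟩
      1#                      ∎

    from-p : ∀ {p q x y} → y - q ≈ s * (p - q) + t * (x - q) → q + υ * (y - q) ≈ p + υ * t * (x - p)
    from-p {p} {q} {x} {y} y≈ = begin
      q + υ * (y - q)
        ≈⟨ +-congˡ (*-congˡ y≈) ⟩
      q + υ * (s * (p - q) + t * (x - q))
        -- The two descriptions of the point differ by a multiple of p - q whose coefficient
        -- vanishes by the choice of υ.
        ≈⟨ solve 6 (λ p q x s t υ → q :+ υ :* (s :* (p :- q) :+ t :* (x :- q)) :=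
             p :+ υ :* t :* (x :- p) :+ (υ :* t :+ υ :* s :- :1) :* (p :- q)) refl p q x s t υ ⟩
      p + υ * t * (x - p) + (υ * t + υ * s - 1#) * (p - q)
        ≈⟨ +-congˡ (*-congʳ (trans (+-congʳ υt+υs≈1) (-‿inverseʳ 1#))) ⟩
      p + υ * t * (x - p) + 0# * (p - q)
        ≈⟨ trans (+-congˡ (zeroˡ (p - q))) (+-identityʳ _) ⟩
      p + υ * t * (x - p) ∎

-- Inversion sets and the action of permutations

open ≡ using (refl)

injective : ∀ {A B : Set} (f : A ↔ B) {x y} → Inverse.to f x ≡ Inverse.to f y → x ≡ y
injective f = Injection.injective (↔⇒↣ f)

moveʳ : ∀ {A B : Set} (f : A ↔ B) {x y} → Inverse.from f y ≡ x → y ≡ Inverse.to f x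
moveʳ f eq = ≡.trans (≡.sym (Inverse.strictlyInverseˡ f _)) (cong (Inverse.to f) eq)

-- These are bijections on all pairs, so that they can be inverted; they agree with `ρ ∗_` on the
-- pairs that ρ preserves and reverses, respectively.
pairs reversedPairs : ∀ {n} → Permutation′ n → (Fin n × Fin n) ↔ (Fin n × Fin n)
pairs ρ         = ρ ×-↔ ρ
reversedPairs ρ = ×-comm _ _ ↔-∘ pairs ρ

-- Membership in `E π` says that the first entry is the smaller one, so this single equivalence,
-- required for all pairs, contains both the image condition and the order condition.
Intertwines : ∀ {n} → (Fin n × Fin n) ↔ (Fin n × Fin n) → Permutation′ n → Permutation′ n → Set
Intertwines g σ π = ∀ p → p ∈ E σ ⇔ Inverse.to g p ∈ E π

∗-preserving : ∀ {n} (ρ : Permutation′ n) p → p ∈ OrderPreserving ρ → ρ ∗ p ≡ Inverse.to (pairs ρ) p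
∗-preserving ρ (i , j) ρi<ρj rewrite dec-true ((ρ ⟨$⟩ʳ i) Fin.<? (ρ ⟨$⟩ʳ j)) ρi<ρj = refl

∗-reversing : ∀ {n} (ρ : Permutation′ n) p → p ∈ OrderReversing ρ → ρ ∗ p ≡ Inverse.to (reversedPairs ρ) p
∗-reversing ρ (i , j) ρj<ρi rewrite dec-false ((ρ ⟨$⟩ʳ i) Fin.<? (ρ ⟨$⟩ʳ j)) (ℕ.<-asym ρj<ρi) = refl

-- On A the action is the bijection g: injectivity of g identifies the preimage of an image pair,
-- and its inverse supplies a preimage for every pair of B.
∗ˢ-image : ∀ {n} (ρ : Permutation′ n) (g : (Fin n × Fin n) ↔ (Fin n × Fin n)) {A B : Pred (Fin n × Fin n) 0ℓ} →
           (∀ p → p ∈ A → ρ ∗ p ≡ Inverse.to g p) →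
           (ρ ∗ˢ A ≐ B) ⇔ (∀ p → p ∈ A ⇔ Inverse.to g p ∈ B)
∗ˢ-image ρ g {A} {B} ρ∗≡g = mk⇔ forwards backwards
  where
  open Inverse g using (to; from; strictlyInverseˡ)

  forwards : ρ ∗ˢ A ≐ B → ∀ p → p ∈ A ⇔ to p ∈ B
  forwards (image⊆B , B⊆image) p = mk⇔
    (λ p∈A → image⊆B (p , p∈A , ≡.sym (ρ∗≡g p p∈A)))
    (λ gp∈B → preimage (B⊆image gp∈B))
    where
    preimage : to p ∈ ρ ∗ˢ A → p ∈ A
    preimage (p′ , p′∈A , gp≡) = subst A (≡.sym (injective g (≡.trans gp≡ (ρ∗≡g p′ p′∈A)))) p′∈A

  backwards : (∀ p → p ∈ A ⇔ to p ∈ B) → ρ ∗ˢ A ≐ B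
  backwards A⇔B = image⊆B , B⊆image
    where
    image⊆B : ρ ∗ˢ A ⊆ B
    image⊆B (p , p∈A , q≡) = subst B (≡.sym (≡.trans q≡ (ρ∗≡g p p∈A))) (Equivalence.to (A⇔B p) p∈A)

    B⊆image : B ⊆ ρ ∗ˢ A
    B⊆image {q} q∈B = from q , p∈A , ≡.trans (≡.sym (strictlyInverseˡ q)) (≡.sym (ρ∗≡g (from q) p∈A))
      where
      p∈A : from q ∈ A
      p∈A = Equivalence.from (A⇔B (from q)) (subst B (≡.sym (strictlyInverseˡ q)) q∈B)

Condition : ∀ {n} → Permutation′ n → Permutation′ n → Permutation′ n → Set
Condition ρ σ π = (ρ ∗ˢ E σ ≐ E π) × (E σ ⊆ OrderPreserving ρ ⊎ E σ ⊆ OrderReversing ρ)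

-- The order condition selects the bijection that the action agrees with on `E σ`. Conversely it is
-- read off from the increasing order of the image pairs in `E π`.
condition⇔intertwines : ∀ {n} (ρ σ π : Permutation′ n) →
                        Condition ρ σ π ⇔ (Intertwines (pairs ρ) σ π ⊎ Intertwines (reversedPairs ρ) σ π)
condition⇔intertwines ρ σ π = mk⇔ forwards backwards
  where
  preserving-image : E σ ⊆ OrderPreserving ρ → (ρ ∗ˢ E σ ≐ E π) ⇔ Intertwines (pairs ρ) σ π
  preserving-image preserving = ∗ˢ-image ρ (pairs ρ) λ p p∈E → ∗-preserving ρ p (preserving p∈E)

  reversing-image : E σ ⊆ OrderReversing ρ → (ρ ∗ˢ E σ ≐ E π) ⇔ Intertwines (reversedPairs ρ) σ π
  reversing-image reversing = ∗ˢ-image ρ (reversedPairs ρ) λ p p∈E → ∗-reversing ρ p (reversing p∈E)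

  forwards : Condition ρ σ π → Intertwines (pairs ρ) σ π ⊎ Intertwines (reversedPairs ρ) σ π
  forwards (image , inj₁ preserving) = inj₁ (Equivalence.to (preserving-image preserving) image)
  forwards (image , inj₂ reversing)  = inj₂ (Equivalence.to (reversing-image reversing) image)

  backwards : Intertwines (pairs ρ) σ π ⊎ Intertwines (reversedPairs ρ) σ π → Condition ρ σ π
  backwards (inj₁ intertwines) = Equivalence.from (preserving-image preserving) intertwines , inj₁ preserving
    where
    preserving : E σ ⊆ OrderPreserving ρ
    preserving {p} p∈E = proj₁ (Equivalence.to (intertwines p) p∈E)
  backwards (inj₂ intertwines) = Equivalence.from (reversing-image reversing) intertwines , inj₂ reversing
    where
    reversing : E σ ⊆ OrderReversing ρ
    reversing {p} p∈E = proj₁ (Equivalence.to (intertwines p) p∈E)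

-- The graph K₂,ₙ

-- Used twice, it cuts the sixteen constructor cases for a pair of edges down to four.
edge-elim : ∀ {n ℓ} (Q : K₂-Vertex n → K₂-Vertex n → Set ℓ) → (∀ {x y} → Q x y → Q y x) →
            (∀ i → Q a (leaf i)) → (∀ i → Q b (leaf i)) → ∀ {x y} → K₂-Adj x y → Q x y
edge-elim Q flip a-leaf b-leaf a–leaf = a-leaf _
edge-elim Q flip a-leaf b-leaf leaf–a = flip (a-leaf _)
edge-elim Q flip a-leaf b-leaf b–leaf = b-leaf _
edge-elim Q flip a-leaf b-leaf leaf–b = flip (b-leaf _)

-- The combinatorial model of the crossing relation, free of coordinates. Flipping the second edge
-- is `c-swap`, `c-flip`, `c-swap`.
data Crossing {n} (π : Permutation′ n) : K₂-Vertex n × K₂-Vertex n → K₂-Vertex n × K₂-Vertex n → Set where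
  a×b    : ∀ {i j} → (j , i) ∈ E π → Crossing π (a , leaf i) (b , leaf j)
  c-swap : ∀ {e e′} → Crossing π e e′ → Crossing π e′ e
  c-flip : ∀ {x y e} → Crossing π (x , y) e → Crossing π (y , x) e

-- For n = 2 it only matters whether there is an inversion at all.
Crossing⇒∃E : ∀ {n} {π : Permutation′ n} {e e′} → Crossing π e e′ → ∃[ p ] p ∈ E π
Crossing⇒∃E (a×b p∈E)  = _ , p∈E
Crossing⇒∃E (c-swap c) = Crossing⇒∃E c
Crossing⇒∃E (c-flip c) = Crossing⇒∃E c

leaf-injective : ∀ {n} {i j : Fin n} → leaf i ≡ leaf j → i ≡ j
leaf-injective refl = refl

-- Indexing by `Fin 2` makes the pigeonhole principle applicable to leaves sent to hubs.
hub : ∀ {n} → Fin 2 → K₂-Vertex n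
hub zero       = a
hub (suc zero) = b

hub≢leaf : ∀ {n} {i : Fin n} h → hub h ≢ leaf i
hub≢leaf zero       ()
hub≢leaf (suc zero) ()

hub-or-leaf : ∀ {n} (x : K₂-Vertex n) → (∃[ h ] x ≡ hub h) ⊎ (∃[ i ] x ≡ leaf i)
hub-or-leaf a        = inj₁ (zero , refl)
hub-or-leaf b        = inj₁ (suc zero , refl)
hub-or-leaf (leaf i) = inj₂ (i , refl)

hub-neighbour : ∀ {n} {x : K₂-Vertex n} h → K₂-Adj (hub h) x → ∃[ i ] x ≡ leaf i
hub-neighbour zero       a–leaf = _ , refl
hub-neighbour (suc zero) b–leaf = _ , refl

leaf-neighbour : ∀ {n} {x : K₂-Vertex n} {i} → K₂-Adj (leaf i) x → ∃[ h ] x ≡ hub h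
leaf-neighbour leaf–a = zero , refl
leaf-neighbour leaf–b = suc zero , refl

-- If a goes to a leaf then the n leaves go to the two hubs, so n ≤ 2; and for
-- n = 1 both hubs would go to the only leaf.
a↦leaf⇒n≡2 : ∀ {n k} (f : K₂-Vertex n ↔ K₂-Vertex n) →
             (∀ {x y} → K₂-Adj x y → K₂-Adj (Inverse.to f x) (Inverse.to f y)) →
             Inverse.to f a ≡ leaf k → n ≡ 2
a↦leaf⇒n≡2 {1} {zero} f f-adj fa≡leaf
  with h , f0≡hub ← leaf-neighbour (subst (λ x → K₂-Adj x (Inverse.to f (leaf zero))) fa≡leaf (f-adj a–leaf))
  with zero , fb≡leaf ← hub-neighbour h (subst (λ x → K₂-Adj x (Inverse.to f b)) f0≡hub (f-adj leaf–b)) =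
  contradiction (injective f (≡.trans fa≡leaf (≡.sym fb≡leaf))) λ()
a↦leaf⇒n≡2 {2} f f-adj fa≡leaf = refl
a↦leaf⇒n≡2 {suc (suc (suc n))} f f-adj fa≡leaf =
  let i , j , i<j , hᵢ≡hⱼ = Fin.pigeonhole (s<s (s<s z<s)) (proj₁ ∘ leaf↦hub) in
  contradiction (leaf-injective (injective f (fi≡fj hᵢ≡hⱼ))) (Fin.<⇒≢ i<j)
  where
  open Inverse f using (to)

  leaf↦hub : ∀ i → ∃[ h ] to (leaf i) ≡ hub h
  leaf↦hub i = leaf-neighbour (subst (λ x → K₂-Adj x (to (leaf i))) fa≡leaf (f-adj a–leaf))

  fi≡fj : ∀ {i j} → proj₁ (leaf↦hub i) ≡ proj₁ (leaf↦hub j) → to (leaf i) ≡ to (leaf j)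
  fi≡fj {i} {j} hᵢ≡hⱼ = ≡.trans (proj₂ (leaf↦hub i)) (≡.trans (cong hub hᵢ≡hⱼ) (≡.sym (proj₂ (leaf↦hub j))))

module K₂-Isomorphism {n} (f : K₂-Vertex n ↔ K₂-Vertex n)
                      (f-adj : ∀ {x y} → K₂-Adj x y → K₂-Adj (Inverse.to f x) (Inverse.to f y)) where
  open Inverse f using (to; from; strictlyInverseʳ)

  module _ {h} (fa≡hub : to a ≡ hub h) where

    leaf↦leaf : ∀ i → ∃[ k ] to (leaf i) ≡ leaf k
    leaf↦leaf i = hub-neighbour h (subst (λ x → K₂-Adj x (to (leaf i))) fa≡hub (f-adj a–leaf))

    b↦hub : ∃[ h′ ] to b ≡ hub h′
    b↦hub with hub-or-leaf (to b)
    ... | inj₁ fb≡hub = fb≡hub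
    -- The label k also names a leaf of the domain. Its image is a leaf as well, yet would be
    -- adjacent to the image of b, a leaf.
    ... | inj₂ (k , fb≡leaf) with subst₂ K₂-Adj fb≡leaf (proj₂ (leaf↦leaf k)) (f-adj b–leaf)
    ...   | ()

    -- By exclusion: a and b are sent to hubs, so neither can be the preimage of a leaf.
    leaf↤leaf : ∀ k → ∃[ i ] from (leaf k) ≡ leaf i
    leaf↤leaf k with from (leaf k) in eq
    ... | a      = contradiction (≡.trans (≡.sym fa≡hub) (≡.sym (moveʳ f eq))) (hub≢leaf h)
    ... | b      = contradiction (≡.trans (≡.sym (proj₂ b↦hub)) (≡.sym (moveʳ f eq))) (hub≢leaf (proj₁ b↦hub))
    ... | leaf i = i , refl

    leafPermutation : ∃[ ρ ] (∀ i → to (leaf i) ≡ leaf (ρ ⟨$⟩ʳ i))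
    leafPermutation = permutation (proj₁ ∘ leaf↦leaf) (proj₁ ∘ leaf↤leaf) to∘from from∘to , proj₂ ∘ leaf↦leaf
      where
      to∘from : ∀ k → proj₁ (leaf↦leaf (proj₁ (leaf↤leaf k))) ≡ k
      to∘from k = leaf-injective (≡.trans (≡.sym (proj₂ (leaf↦leaf _))) (≡.sym (moveʳ f (proj₂ (leaf↤leaf k)))))

      from∘to : ∀ i → proj₁ (leaf↤leaf (proj₁ (leaf↦leaf i))) ≡ i
      from∘to i = leaf-injective (≡.trans (≡.sym (proj₂ (leaf↤leaf _)))
        (≡.trans (cong from (≡.sym (proj₂ (leaf↦leaf i)))) (strictlyInverseʳ (leaf i))))

-- Vertex bijections induced by a leaf permutation

relabel : ∀ {n} → Permutation′ n → K₂-Vertex n ↔ K₂-Vertex n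
relabel ρ = mk↔ₛ′
  (λ { a → a ; b → b ; (leaf i) → leaf (ρ ⟨$⟩ʳ i) })
  (λ { a → a ; b → b ; (leaf i) → leaf (ρ ⟨$⟩ˡ i) })
  (λ { a → refl ; b → refl ; (leaf i) → cong leaf (inverseʳ ρ) })
  (λ { a → refl ; b → refl ; (leaf i) → cong leaf (inverseˡ ρ) })

mirror : ∀ {n} → K₂-Vertex n ↔ K₂-Vertex n
mirror = mk↔ₛ′ exchange exchange involutive involutive
  where
  exchange : ∀ {n} → K₂-Vertex n → K₂-Vertex n
  exchange a        = b
  exchange b        = a
  exchange (leaf i) = leaf i

  involutive : ∀ {n} (x : K₂-Vertex n) → exchange (exchange x) ≡ x
  involutive a        = refl
  involutive b        = refl
  involutive (leaf i) = refl

-- Checks on the generating edges and crossings suffice, since the rest follows by symmetry. One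
-- instance for a bijection and one for its inverse give a geo-isomorphism.
record Respects {n} (σ π : Permutation′ n) (f : K₂-Vertex n → K₂-Vertex n) : Set where
  constructor respects
  field
    a-adj   : ∀ i → K₂-Adj (f a) (f (leaf i))
    b-adj   : ∀ i → K₂-Adj (f b) (f (leaf i))
    a×b-map : ∀ {i j} → (j , i) ∈ E σ → Crossing π (f a , f (leaf i)) (f b , f (leaf j))

  adj : ∀ {x y} → K₂-Adj x y → K₂-Adj (f x) (f y)
  adj = edge-elim (λ x y → K₂-Adj (f x) (f y)) (SimpleGraph.sym (K₂ n)) a-adj b-adj

  crossing : ∀ {x y u v} → Crossing σ (x , y) (u , v) → Crossing π (f x , f y) (f u , f v)
  crossing (a×b p∈E)  = a×b-map p∈E
  crossing (c-swap c) = c-swap (crossing c)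
  crossing (c-flip c) = c-flip (crossing c)

intertwines-from : ∀ {n} g {σ π : Permutation′ n} → Intertwines g σ π → ∀ {p} → p ∈ E π → Inverse.from g p ∈ E σ
intertwines-from g {π = π} intertwines {p} p∈E =
  Equivalence.from (intertwines (Inverse.from g p)) (subst (E π) (≡.sym (Inverse.strictlyInverseˡ g p)) p∈E)

relabel-respects : ∀ {n} (ρ : Permutation′ n) {σ π} → Intertwines (pairs ρ) σ π →
                   Respects σ π (Inverse.to (relabel ρ)) × Respects π σ (Inverse.from (relabel ρ))
relabel-respects ρ {σ} {π} intertwines =
  respects (λ _ → a–leaf) (λ _ → b–leaf) (λ p∈E → a×b (Equivalence.to (intertwines _) p∈E)) ,
  respects (λ _ → a–leaf) (λ _ → b–leaf) (λ p∈E → a×b (intertwines-from (pairs ρ) {σ} {π} intertwines p∈E))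

-- Once the hubs are exchanged, the crossing of a-i and b-j becomes one of b-ρ(i) and a-ρ(j), which
-- belongs to the pair (ρ(i), ρ(j)), the reversed image of (j , i).
mirror-respects : ∀ {n} (ρ : Permutation′ n) {σ π} → Intertwines (reversedPairs ρ) σ π →
                  Respects σ π (Inverse.to (mirror ↔-∘ relabel ρ)) × Respects π σ (Inverse.from (mirror ↔-∘ relabel ρ))
mirror-respects ρ {σ} {π} intertwines =
  respects (λ _ → b–leaf) (λ _ → a–leaf) (λ p∈E → c-swap (a×b (Equivalence.to (intertwines _) p∈E))) ,
  respects (λ _ → b–leaf) (λ _ → a–leaf)
    (λ p∈E → c-swap (a×b (intertwines-from (reversedPairs ρ) {σ} {π} intertwines p∈E)))

-- Two labels admit only one increasing pair.
E-Fin2-unique : ∀ {σ π : Permutation′ 2} {p q} → p ∈ E σ → q ∈ E π → p ∈ E π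
E-Fin2-unique {σ} {π} p∈E q∈E = subst (E π) (≡.trans (only-pair {π} q∈E) (≡.sym (only-pair {σ} p∈E))) q∈E
  where
  only-pair : ∀ {τ : Permutation′ 2} {p} → p ∈ E τ → p ≡ (zero , suc zero)
  only-pair {p = zero     , zero}     (() , _)
  only-pair {p = zero     , suc zero} _ = refl
  only-pair {p = suc zero , zero}     (() , _)
  only-pair {p = suc zero , suc zero} (s<s () , _)

-- Crossings of realizations

module GeometricGraphProperties {c ℓ₁ ℓ₂ ℓ₃} (F : OrderedField c ℓ₁ ℓ₂ ℓ₃)
                                (G : Plane.GeometricGraph F) where
  open Plane F
  open PlaneProperties F
  open GeometricGraph G
  open GeneralPosition generalPosition

  crosses-swap : ∀ {e e′} → Crosses e e′ → Crosses e′ e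
  crosses-swap (adj , adj′ , different , z , z∈ , z∈′) =
    adj′ , adj , different ∘ same-sym , z , z∈′ , z∈
    where
    same-sym : ∀ {x y u v} → SameEdge (x , y) (u , v) → SameEdge (u , v) (x , y)
    same-sym (inj₁ (refl , refl)) = inj₁ (refl , refl)
    same-sym (inj₂ (refl , refl)) = inj₂ (refl , refl)

  crosses-flip : ∀ {x y e} → Crosses (x , y) e → Crosses (y , x) e
  crosses-flip (adj , adj′ , different , z , z∈ , z∈′) =
    sym adj , adj′ , different ∘ same-flip , z , Interior-sym z∈ , z∈′
    where
    same-flip : ∀ {x y u v} → SameEdge (y , x) (u , v) → SameEdge (x , y) (u , v)
    same-flip (inj₁ (refl , refl)) = inj₂ (refl , refl)
    same-flip (inj₂ (refl , refl)) = inj₁ (refl , refl)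

  -- Different edges at x have different far endpoints, which general position keeps off a common
  -- line through x.
  incident-edges-do-not-cross : ∀ {x y v} → ¬ Crosses (x , y) (x , v)
  incident-edges-do-not-cross (xy , xv , different , z , z∈ , z∈′) =
    interiors-disjoint
      (noCollinear (λ { refl → irrefl xy }) (λ { refl → different (inj₁ (refl , refl)) }) (λ { refl → irrefl xv }))
      z∈ z∈′

module RealizationProperties {c ℓ₁ ℓ₂ ℓ₃} (F : OrderedField c ℓ₁ ℓ₂ ℓ₃)
                             {n} {π : Permutation′ n} (P : Plane.Realization F π) where
  open Plane F
  open PlaneProperties F
  open Realization P
  open GeneralPosition generalPosition using (noCollinear)
  open GeometricGraph K̄ using (Crosses)
  open GeometricGraphProperties F K̄

  -- `orderA` compares positions in the order of rays at a, and the ray with label i has position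
  -- π⁻¹(i).
  angleA : ∀ {i j} → (π ⟨$⟩ˡ i) Fin.< (π ⟨$⟩ˡ j) → SmallerAngle ab (pos (leaf i) -ᵥ pa) (pos (leaf j) -ᵥ pa)
  angleA {i} {j} i<j =
    SmallerAngle-points (proj₁ (proj₂ (meet i i))) (proj₁ (proj₂ (meet j j)))
      (subst₂ (λ i j → SmallerAngle ab (rayA i) (rayA j)) (inverseʳ π) (inverseʳ π) (orderA i<j))

  angleB : ∀ {i j} → i Fin.< j → SmallerAngle ba (pos (leaf i) -ᵥ pb) (pos (leaf j) -ᵥ pb)
  angleB {i} {j} i<j =
    SmallerAngle-points (proj₂ (proj₂ (meet i i))) (proj₂ (proj₂ (meet j j))) (orderB i<j)

  -- Trichotomy on labels and positions is decidable although the order of the field need not be;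
  -- every case other than an inversion contradicts the common point.
  crosses⇒E : ∀ {i j} → Crosses (a , leaf i) (b , leaf j) → (j , i) ∈ E π
  crosses⇒E {i} {j} crosses@(_ , _ , _ , z , z∈ai , z∈bj) with Fin.<-cmp j i
  ... | tri> _ _ i<j = contradiction z∈bj
    (smallerAngle⇒disjoint (noCollinear {b} {a} {leaf j} (λ ()) (λ ()) (λ ())) (angleB i<j) z∈ai)
  -- Both edges end at the same leaf; flipping each of them brings it to the front.
  ... | tri≈ _ refl _ = contradiction (crosses-swap (crosses-flip (crosses-swap (crosses-flip crosses))))
    incident-edges-do-not-cross
  ... | tri< j<i j≢i _ with Fin.<-cmp (π ⟨$⟩ˡ i) (π ⟨$⟩ˡ j)
  ...   | tri< πi<πj _ _ = j<i , πi<πj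
  ...   | tri≈ _ πi≡πj _ = contradiction (≡.sym (injective (Perm.flip π) πi≡πj)) j≢i
  ...   | tri> _ _ πj<πi = contradiction z∈ai
    (smallerAngle⇒disjoint (noCollinear {a} {b} {leaf i} (λ ()) (λ ()) (λ ())) (angleA πj<πi) z∈bj)

  E⇒crosses : ∀ {i j} → (j , i) ∈ E π → Crosses (a , leaf i) (b , leaf j)
  E⇒crosses (j<i , πi<πj) =
    a–leaf , b–leaf , (λ { (inj₁ (() , _)) ; (inj₂ (() , _)) }) ,
    smallerAngles⇒cross (noCollinear {b} {leaf _} {a} (λ ()) (λ ()) (λ ())) (angleB j<i) (angleA πi<πj)

  -- With both edges directed away from their hubs, edges at the same hub are incident and do not
  -- cross, and edges at different hubs are settled by `crosses⇒E`.
  crosses⇒crossing : ∀ {x y u v} → Crosses (x , y) (u , v) → Crossing π (x , y) (u , v)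
  crosses⇒crossing crosses@(xy , uv , _) =
    edge-elim (λ x y → ∀ {u v} → K₂-Adj u v → Crosses (x , y) (u , v) → Crossing π (x , y) (u , v))
      (λ from-flipped uv → c-flip ∘ from-flipped uv ∘ crosses-flip)
      (λ i → edge-elim (λ u v → Crosses (a , leaf i) (u , v) → Crossing π (a , leaf i) (u , v)) flipʳ
        (λ j ai×aj → contradiction ai×aj incident-edges-do-not-cross)
        (λ j → a×b ∘ crosses⇒E))
      (λ i → edge-elim (λ u v → Crosses (b , leaf i) (u , v) → Crossing π (b , leaf i) (u , v)) flipʳ
        (λ j → c-swap ∘ a×b ∘ crosses⇒E ∘ crosses-swap)
        (λ j bi×bj → contradiction bi×bj incident-edges-do-not-cross))
      xy uv crosses
    where
    flipʳ : ∀ {e u v} → (Crosses e (u , v) → Crossing π e (u , v)) → Crosses e (v , u) → Crossing π e (v , u)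
    flipʳ unflipped = c-swap ∘ c-flip ∘ c-swap ∘ unflipped ∘ crosses-swap ∘ crosses-flip ∘ crosses-swap

  crossing⇒crosses : ∀ {e e′} → Crossing π e e′ → Crosses e e′
  crossing⇒crosses (a×b p∈E)  = E⇒crosses p∈E
  crossing⇒crosses (c-swap c) = crosses-swap (crossing⇒crosses c)
  crossing⇒crosses (c-flip c) = crosses-flip (crossing⇒crosses c)

-- Geo-isomorphisms and intertwining permutations

module GeoEquivalence {c ℓ₁ ℓ₂ ℓ₃} (F : OrderedField c ℓ₁ ℓ₂ ℓ₃)
                      {n} {σ π : Permutation′ n} (S : Plane.Realization F σ) (P : Plane.Realization F π) where
  open Plane F
  private
    module S = RealizationProperties F S
    module P = RealizationProperties F P

  geoIsomorphism : (f : K₂-Vertex n ↔ K₂-Vertex n) →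
                   Respects σ π (Inverse.to f) → Respects π σ (Inverse.from f) → GeoEquivalent S P
  geoIsomorphism f to-respects from-respects = record
    { bijection = f
    ; adjacent  = λ u v → mk⇔ to.adj
        (subst₂ K₂-Adj (strictlyInverseʳ u) (strictlyInverseʳ v) ∘ from.adj)
    ; crosses   = λ x y u v → mk⇔
        (P.crossing⇒crosses ∘ to.crossing ∘ S.crosses⇒crossing)
        (S.crossing⇒crosses ∘
         subst₂ (Crossing σ) (≡.cong₂ _,_ (strictlyInverseʳ x) (strictlyInverseʳ y))
                             (≡.cong₂ _,_ (strictlyInverseʳ u) (strictlyInverseʳ v)) ∘
         from.crossing ∘ P.crosses⇒crossing)
    }
    where
    module to   = Respects to-respects
    module from = Respects from-respects
    open Inverse f using (strictlyInverseʳ)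

  module _ (iso : GeoEquivalent S P) where
    open GeoIsomorphism iso
    open Inverse bijection using (strictlyInverseˡ)
    open GeometricGraph (Realization.K̄ P) using (Crosses)
    open GeometricGraphProperties F (Realization.K̄ P) using (crosses-swap)

    f-adj : ∀ {x y} → K₂-Adj x y → K₂-Adj (f x) (f y)
    f-adj = Equivalence.to (adjacent _ _)

    -- Nothing is assumed about the images of the hubs, so this remains available when a goes to a
    -- leaf.
    ∃E-σ⇒π : ∀ {p} → p ∈ E σ → ∃[ q ] q ∈ E π
    ∃E-σ⇒π p∈E = Crossing⇒∃E (P.crosses⇒crossing (Equivalence.to (crosses _ _ _ _) (S.E⇒crosses p∈E)))

    ∃E-π⇒σ : ∀ {p} → p ∈ E π → ∃[ q ] q ∈ E σ
    ∃E-π⇒σ {j , i} p∈E = Crossing⇒∃E (S.crosses⇒crossing (Equivalence.from (crosses _ _ _ _)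
      -- Each endpoint is written as f of its preimage, so that the equivalence of crossings can be
      -- read backwards.
      (subst₂ Crosses
        (≡.sym (≡.cong₂ _,_ (strictlyInverseˡ a) (strictlyInverseˡ (leaf i))))
        (≡.sym (≡.cong₂ _,_ (strictlyInverseˡ b) (strictlyInverseˡ (leaf j))))
        (P.E⇒crosses p∈E))))

    -- Both inversion sets lie in the same singleton, and each is inhabited as soon as the other is.
    intertwines-identity : n ≡ 2 → Intertwines (pairs Perm.id) σ π
    intertwines-identity refl p = mk⇔
      (λ p∈E → E-Fin2-unique {σ} {π} p∈E (proj₂ (∃E-σ⇒π p∈E)))
      (λ p∈E → E-Fin2-unique {π} {σ} p∈E (proj₂ (∃E-π⇒σ p∈E)))

    -- The hubs stay unspecified here, so that one argument serves fixed and exchanged hubs alike.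
    crosses-relabelled : ∀ {h h′} (ρ : Permutation′ n) → f a ≡ hub h → f b ≡ hub h′ →
      (∀ i → f (leaf i) ≡ leaf (ρ ⟨$⟩ʳ i)) →
      ∀ i j → (j , i) ∈ E σ ⇔ Crosses (hub h , leaf (ρ ⟨$⟩ʳ i)) (hub h′ , leaf (ρ ⟨$⟩ʳ j))
    crosses-relabelled ρ fa fb f-leaf i j = mk⇔
      (subst₂ Crosses edge-a edge-b ∘ Equivalence.to (crosses _ _ _ _) ∘ S.E⇒crosses)
      (S.crosses⇒E ∘ Equivalence.from (crosses _ _ _ _) ∘ subst₂ Crosses (≡.sym edge-a) (≡.sym edge-b))
      where
      edge-a = ≡.cong₂ _,_ fa (f-leaf i)
      edge-b = ≡.cong₂ _,_ fb (f-leaf j)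

    intertwines : ∃[ ρ ] (Intertwines (pairs ρ) σ π ⊎ Intertwines (reversedPairs ρ) σ π)
    intertwines with hub-or-leaf (f a)
    ... | inj₂ (_ , fa≡leaf) = Perm.id , inj₁ (intertwines-identity (a↦leaf⇒n≡2 bijection f-adj fa≡leaf))
    ... | inj₁ (h , fa≡hub) = ρ , by-hubs h h′ h≢h′
            (crosses-relabelled ρ fa≡hub fb≡hub (proj₂ (leafPermutation fa≡hub)))
      where
      open K₂-Isomorphism bijection f-adj
      ρ      = proj₁ (leafPermutation fa≡hub)
      h′     = proj₁ (b↦hub fa≡hub)
      fb≡hub = proj₂ (b↦hub fa≡hub)

      h≢h′ : h ≢ h′
      h≢h′ h≡h′ = contradiction (injective bijection (≡.trans fa≡hub (≡.trans (cong hub h≡h′) (≡.sym fb≡hub)))) λ()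

      -- The two hubs are generalised to variables in order to be matched on. Fixed hubs give
      -- `pairs ρ`; for exchanged hubs the swap of the edges reverses the pair.
      by-hubs : ∀ k k′ → k ≢ k′ →
                (∀ i j → (j , i) ∈ E σ ⇔ Crosses (hub k , leaf (ρ ⟨$⟩ʳ i)) (hub k′ , leaf (ρ ⟨$⟩ʳ j))) →
                Intertwines (pairs ρ) σ π ⊎ Intertwines (reversedPairs ρ) σ π
      by-hubs zero       zero       k≢k′ _ = contradiction refl k≢k′
      by-hubs (suc zero) (suc zero) k≢k′ _ = contradiction refl k≢k′
      by-hubs zero       (suc zero) _ crosses⇔ = inj₁ λ (j , i) → mk⇔
        (P.crosses⇒E ∘ Equivalence.to (crosses⇔ i j))
        (Equivalence.from (crosses⇔ i j) ∘ P.E⇒crosses)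
      by-hubs (suc zero) zero       _ crosses⇔ = inj₂ λ (j , i) → mk⇔
        (P.crosses⇒E ∘ crosses-swap ∘ Equivalence.to (crosses⇔ i j))
        (Equivalence.from (crosses⇔ i j) ∘ crosses-swap ∘ P.E⇒crosses)

  geoEquivalent⇔intertwines : GeoEquivalent S P ⇔
    (∃[ ρ ] (Intertwines (pairs ρ) σ π ⊎ Intertwines (reversedPairs ρ) σ π))
  geoEquivalent⇔intertwines = mk⇔ intertwines backwards
    where
    backwards : ∃[ ρ ] (Intertwines (pairs ρ) σ π ⊎ Intertwines (reversedPairs ρ) σ π) → GeoEquivalent S P
    backwards (ρ , inj₁ preserving) =
      let to-respects , from-respects = relabel-respects ρ preserving
      in geoIsomorphism (relabel ρ) to-respects from-respects
    backwards (ρ , inj₂ reversing) =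
      let to-respects , from-respects = mirror-respects ρ reversing
      in geoIsomorphism (mirror ↔-∘ relabel ρ) to-respects from-respects

theorem3 : ∀ {c ℓ₁ ℓ₂ ℓ₃} (F : OrderedField c ℓ₁ ℓ₂ ℓ₃) →
    let open Plane F in
    (n : ℕ) (σ π : Permutation′ n) (S : Realization σ) (P : Realization π) →
    GeoEquivalent S P ⇔
    (∃[ ρ ] (ρ ∗ˢ E σ ≐ E π) × (E σ ⊆ OrderPreserving ρ ⊎ E σ ⊆ OrderReversing ρ))
theorem3 F n σ π S P = mk⇔
  (λ iso → let ρ , intertwines = Equivalence.to geoEquivalent⇔intertwines iso
           in ρ , Equivalence.from (condition⇔intertwines ρ σ π) intertwines)
  (λ (ρ , condition) → Equivalence.from geoEquivalent⇔intertwines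
                         (ρ , Equivalence.to (condition⇔intertwines ρ σ π) condition))
  where open GeoEquivalence F S P
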